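{- Let $n,m\ge 5$ be integers with $m\equiv 2\pmod 4$ and $n\equiv 2\pmod 4$. Then $\gamma_p(C_n\times C_m)\le\frac{(n+2)(m+2)}{4}-6$.
   Context: All graphs are finite, simple and undirected. $C_n$ denotes the cycle of order $n$ and $G\times H$ the Cartesian product of graphs. For a graph $G$ without isolated vertices, a set $D\subseteq V(G)$ is a paired dominating set if every vertex outside $D$ has a neighbour in $D$ and the induced subgraph $G[D]$ has a perfect matching; $\gamma_p(G)$ is the minimum size of a paired dominating set. -}

module Defs where

open import Data.Fin using (Fin; toℕ; remQuot)
open import Data.Fin.Subset using (Subset; _∈_; _∉_; ∣_∣)
open import Data.Nat using (ℕ; suc; _*_; _≤_)
open import Data.Product using (∃; ∃-syntax; ∃!; _×_; _,_; proj₁)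
open import Data.Sum using (_⊎_; inj₁; inj₂; swap)
open import Function using (_on_)
open import Level using (0ℓ)
open import Relation.Binary using (Rel; Symmetric; Irreflexive; _⇒_)
open import Relation.Binary.PropositionalEquality using (_≡_; _≢_; refl; sym; cong; ≢-sym)

record Graph (V : Set) : Set₁ where
  field
    Adj     : Rel V 0ℓ
    adj-sym : Symmetric Adj
    adj-irr : Irreflexive _≡_ Adj

open Graph public

pullback : ∀ {V W : Set} → (V → W) → Graph W → Graph V
pullback f G = record
  { Adj     = Adj G on f
  ; adj-sym = adj-sym G
  ; adj-irr = λ x≡y → adj-irr G (cong f x≡y)
  }

induced : ∀ {n} → Graph (Fin n) → (D : Subset n) → Graph (∃[ v ] v ∈ D)
induced G D = pullback proj₁ G

Next : ∀ {n} → Rel (Fin n) 0ℓ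
Next {n} i j = (toℕ j ≡ suc (toℕ i)) ⊎ (suc (toℕ i) ≡ n × toℕ j ≡ 0)

-- The cycle 0, 1, …, n - 1, 0.  It is the usual cycle for n ≥ 3; the conjunct
-- i ≢ j only matters for n = 1, where it removes the loop.
C : ∀ n → Graph (Fin n)
C n = record
  { Adj     = λ i j → i ≢ j × (Next i j ⊎ Next j i)
  ; adj-sym = λ (i≢j , e) → ≢-sym i≢j , swap e
  ; adj-irr = λ i≡j (i≢j , _) → i≢j i≡j
  }

infixr 7 _□_

_□_ : ∀ {V W : Set} → Graph V → Graph W → Graph (V × W)
G □ H = record
  { Adj     = λ (g , h) (g′ , h′) → (g ≡ g′ × Adj H h h′) ⊎ (Adj G g g′ × h ≡ h′)
  ; adj-sym = λ { (inj₁ (p , e)) → inj₁ (sym p , adj-sym H e)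
                ; (inj₂ (e , p)) → inj₂ (adj-sym G e , sym p) }
  ; adj-irr = λ { refl (inj₁ (_ , e)) → adj-irr H refl e
                ; refl (inj₂ (e , _)) → adj-irr G refl e }
  }

-- Vertices are renumbered along the bijection remQuot m : Fin (n * m) → Fin n × Fin m,
-- so that sets of vertices can be taken to be Subset (n * m).
_×ᶜ_ : ∀ {n m} → Graph (Fin n) → Graph (Fin m) → Graph (Fin (n * m))
_×ᶜ_ {n} {m} G H = pullback (remQuot {n} m) (G □ H)

-- M is the set of matching edges: every vertex lies on exactly one of them.
record PerfectMatching {V : Set} (G : Graph V) : Set₁ where
  field
    M       : Rel V 0ℓ
    M-sym   : Symmetric M
    M⇒Adj   : M ⇒ Adj G
    covered : ∀ v → ∃! _≡_ (M v)

Dominating : ∀ {n} → Graph (Fin n) → Subset n → Set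
Dominating G D = ∀ v → v ∉ D → ∃[ u ] (u ∈ D × Adj G v u)

PairedDominating : ∀ {n} → Graph (Fin n) → Subset n → Set₁
PairedDominating G D = Dominating G D × PerfectMatching (induced G D)

-- "γₚ(G) = k".  Isolated vertices need not be excluded separately: a graph that has
-- one has no paired dominating set, hence no such k.
record IsPairedDominationNumber {n} (G : Graph (Fin n)) (k : ℕ) : Set₁ where
  field
    attained : ∃[ D ] (PairedDominating G D × ∣ D ∣ ≡ k)
    minimal  : ∀ D → PairedDominating G D → k ≤ ∣ D ∣

{-# OPTIONS --safe #-}
module Submission where

-- A 10 × 10 pattern of dominoes is cut, in each direction, into a core of length 6 and a remainder
-- of length 4.  Repeating the remainder a and b times gives a paired dominating set of the
-- (6 + 4a) × (6 + 4b) torus of size 10 + 8a + 8b + 4ab = (n + 2)(m + 2)/4 - 6.  Its validity is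
-- local, so it suffices to check the pattern against every way in which the rows and columns can
-- succeed one another.  The number γₚ itself exists because, on a finite graph with decidable
-- adjacency, being a paired dominating set is decidable.

open import Defs
open import Data.Bool using (Bool; true; false; if_then_else_)
import Data.Bool.Properties as Bool
open import Data.Fin using (Fin; zero; suc; toℕ; fromℕ; inject₁; combine; remQuot; _↑ˡ_; _↑ʳ_; finToFun; funToFin; #_)
open import Data.Fin.Properties as Fin using (toℕ-fromℕ; toℕ-inject₁; toℕ-injective; toℕ<n; remQuot-combine; combine-surjective; finToFun-funToFin)
open import Data.Fin.Relation.Unary.Top using (view; ‵fromℕ; ‵inj₁)
open import Data.Fin.Subset using (Subset; _∈_; ∣_∣)
open import Data.Fin.Subset.Properties using (_∈?_; anySubset?)
open import Data.Maybe using (Maybe; just; nothing; is-just)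
import Data.Maybe.Properties as Maybe
open import Data.Nat using (ℕ; zero; suc; 2+; _+_; _*_; _∸_; _/_; _%_; _^_; _≤_; _<_; _<?_; s≤s)
open import Data.Nat.DivMod using (m≡m%n+[m/n]*n; m*n/n≡m)
open import Data.Nat.Induction using (Acc; acc; <-wellFounded)
open import Data.Nat.Properties as ℕ using (≤-trans; ≤-reflexive; <⇒≤; ≮⇒≥; suc-injective; +-assoc; +-0-commutativeMonoid; m+n∸n≡m)
open import Data.Nat.Tactic.RingSolver using (solve-∀)
open import Data.Product using (∃-syntax; _×_; _,_; proj₁; proj₂; uncurry)
open import Data.Sum as Sum using (_⊎_; inj₁; inj₂)
open import Data.Vec using (Vec; []; _∷_; lookup; tabulate)
open import Data.Vec.Properties using (lookup∘tabulate; []=⇒lookup; lookup⇒[]=)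
open import Data.Vec.Properties.WithK using ([]=-irrelevant)
open import Function using (_∘_)
open import Relation.Binary using (Rel; Decidable)
open import Relation.Binary.PropositionalEquality using (_≡_; _≢_; _≗_; refl; sym; trans; cong; subst; subst₂; module ≡-Reasoning)
open import Relation.Nullary using (Dec; yes; no; ¬?; contradiction; _×-dec_; _⊎-dec_; _→-dec_)
open import Relation.Nullary.Decidable using (map′; from-yes)

open import Algebra.Properties.CommutativeMonoid.Sum +-0-commutativeMonoid using (sum; sum-cong-≗)

private
  variable
    n m : ℕ

-- Existence of the paired domination number

-- A perfect matching of `D` encoded as an involution along edges. Unlike the relation `M`, maps
-- `Fin n → Fin n` can be enumerated; values outside `D` are left free.
IsMate : Graph (Fin n) → Subset n → (Fin n → Fin n) → Set
IsMate G D f = ∀ v → v ∈ D → f v ∈ D × Adj G v (f v) × f (f v) ≡ v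

-- Enumeration recovers a function only up to pointwise equality, so the property has to be
-- transported along it.
IsMate-resp-≗ : ∀ (G : Graph (Fin n)) {D f g} → f ≗ g → IsMate G D f → IsMate G D g
IsMate-resp-≗ G {D} {f} {g} f≗g mate v v∈D with mate v v∈D
... | fv∈D , adj , ffv≡v =
  subst (_∈ D) (f≗g v) fv∈D , subst (Adj G v) (f≗g v) adj ,
  trans (cong g (sym (f≗g v))) (trans (sym (f≗g (f v))) ffv≡v)

mate⇒perfectMatching : ∀ (G : Graph (Fin n)) {D f} → IsMate G D f → PerfectMatching (induced G D)
mate⇒perfectMatching G {f = f} mate = record
  { M       = λ (u , _) (v , _) → f u ≡ v
  ; M-sym   = λ { {u , u∈D} refl → proj₂ (proj₂ (mate u u∈D)) }
  ; M⇒Adj   = λ { {u , u∈D} refl → proj₁ (proj₂ (mate u u∈D)) }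
  ; covered = λ (u , u∈D) → (f u , proj₁ (mate u u∈D)) , refl ,
                -- Vertices of the induced graph carry membership proofs; their irrelevance reduces
                -- uniqueness of the partner to equality in `Fin n`.
                λ { {_ , fu∈D} refl → cong (f u ,_) ([]=-irrelevant _ fu∈D) }
  }

module _ (G : Graph (Fin n)) {D : Subset n} (PM : PerfectMatching (induced G D)) where
  open PerfectMatching PM

  mateOf : Fin n → Fin n
  mateOf v with v ∈? D
  ... | yes v∈D = proj₁ (proj₁ (covered (v , v∈D)))
  -- A default value, on which `IsMate` puts no condition.
  ... | no  _   = v

  mateOf-covered : ∀ {v} (v∈D : v ∈ D) → mateOf v ≡ proj₁ (proj₁ (covered (v , v∈D)))
  mateOf-covered {v} v∈D with v ∈? D
  ... | yes v∈D′ = cong (λ p → proj₁ (proj₁ (covered (v , p)))) ([]=-irrelevant v∈D′ v∈D)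
  ... | no  v∉D  = contradiction v∈D v∉D

  perfectMatching⇒mate : IsMate G D mateOf
  perfectMatching⇒mate v v∈D
    rewrite mateOf-covered v∈D with covered (v , v∈D)
  ... | (w , w∈D) , vw∈M , _ =
    w∈D , M⇒Adj vw∈M ,
    -- By symmetry of `M`, `v` is a partner of `w`, hence by uniqueness the chosen one.
    trans (mateOf-covered w∈D) (cong proj₁ (proj₂ (proj₂ (covered (w , w∈D))) (M-sym vw∈M)))

module _ (G : Graph (Fin n)) (adj? : Decidable (Adj G)) where

  isMate? : ∀ D f → Dec (IsMate G D f)
  isMate? D f = Fin.all? λ v → v ∈? D →-dec f v ∈? D ×-dec adj? v (f v) ×-dec f (f v) Fin.≟ v

  perfectMatching? : ∀ D → Dec (PerfectMatching (induced G D))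
  perfectMatching? D = map′
    (λ (_ , mate) → mate⇒perfectMatching G mate)
    (λ PM → funToFin (mateOf G PM) ,
            IsMate-resp-≗ G (sym ∘ finToFun-funToFin (mateOf G PM)) (perfectMatching⇒mate G PM))
    -- The numbers below `n ^ n` code all maps `Fin n → Fin n`.
    (Fin.any? {n ^ n} λ k → isMate? D (finToFun k))

  dominating? : ∀ D → Dec (Dominating G D)
  dominating? D = Fin.all? λ v → ¬? (v ∈? D) →-dec Fin.any? λ u → u ∈? D ×-dec adj? v u

  pairedDominating? : ∀ D → Dec (PairedDominating G D)
  pairedDominating? D = dominating? D ×-dec perfectMatching? D

  -- Descent on size: move to a strictly smaller paired dominating set while one exists. The set at
  -- which this stops is minimum and no larger than the initial one.
  pairedDominationNumber-≤ : ∀ D → PairedDominating G D →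
    ∃[ γ ] (IsPairedDominationNumber G γ × γ ≤ ∣ D ∣)
  pairedDominationNumber-≤ D pd = descend D pd (<-wellFounded ∣ D ∣)
    where
    descend : ∀ D → PairedDominating G D → Acc _<_ ∣ D ∣ →
      ∃[ γ ] (IsPairedDominationNumber G γ × γ ≤ ∣ D ∣)
    descend D pd (acc rec) with anySubset? (λ E → pairedDominating? E ×-dec ∣ E ∣ <? ∣ D ∣)
    ... | yes (E , pdE , E<D) =
      let γ , isγ , γ≤E = descend E pdE (rec E<D) in γ , isγ , ≤-trans γ≤E (<⇒≤ E<D)
    ... | no minimal = ∣ D ∣ , record
      { attained = D , pd , refl
      ; minimal  = λ E pdE → ≮⇒≥ λ E<D → minimal (E , pdE , E<D)
      } , ℕ.≤-refl

-- Adjacency on cycles: decidability, successor and predecessor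

next? : Decidable (Next {n})
next? {n} i j = toℕ j ℕ.≟ suc (toℕ i) ⊎-dec suc (toℕ i) ℕ.≟ n ×-dec toℕ j ℕ.≟ 0

C-adj? : ∀ n → Decidable (Adj (C n))
C-adj? n i j = ¬? (i Fin.≟ j) ×-dec (next? i j ⊎-dec next? j i)

□-adj? : ∀ (G : Graph (Fin n)) (H : Graph (Fin m)) →
  Decidable (Adj G) → Decidable (Adj H) → Decidable (Adj (G □ H))
□-adj? G H adjG? adjH? (g , h) (g′ , h′) =
  (g Fin.≟ g′ ×-dec adjH? h h′) ⊎-dec (adjG? g g′ ×-dec h Fin.≟ h′)

next : Fin (suc n) → Fin (suc n)
next i with view i
... | ‵fromℕ         = zero
... | ‵inj₁ {i = j} _ = suc j

prev : Fin (suc n) → Fin (suc n)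
prev {n} zero = fromℕ n
prev (suc i)  = inject₁ i

Next-next : (i : Fin (suc n)) → Next i (next i)
Next-next i with view i
... | ‵fromℕ          = inj₂ (cong suc (toℕ-fromℕ _) , refl)
... | ‵inj₁ {i = j} _ = inj₁ (cong suc (sym (toℕ-inject₁ j)))

Next-prev : (i : Fin (suc n)) → Next (prev i) i
Next-prev zero    = inj₂ (cong suc (toℕ-fromℕ _) , refl)
Next-prev (suc i) = inj₁ (cong suc (sym (toℕ-inject₁ i)))

-- Together with `Next-injective`, this makes `next` and `prev` mutually inverse without unfolding
-- `view`.
Next-functional : ∀ {i j k : Fin n} → Next i j → Next i k → j ≡ k
Next-functional (inj₁ p) (inj₁ q) = toℕ-injective (trans p (sym q))
Next-functional {j = j} (inj₁ p) (inj₂ (q , _)) = contradiction (trans p q) (ℕ.<⇒≢ (toℕ<n j))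
Next-functional {k = k} (inj₂ (p , _)) (inj₁ q) = contradiction (trans q p) (ℕ.<⇒≢ (toℕ<n k))
Next-functional (inj₂ (_ , p)) (inj₂ (_ , q)) = toℕ-injective (trans p (sym q))

Next-injective : ∀ {i j k : Fin n} → Next i k → Next j k → i ≡ j
Next-injective (inj₁ p) (inj₁ q) = toℕ-injective (suc-injective (trans (sym p) q))
Next-injective (inj₁ p) (inj₂ (_ , q)) = contradiction (trans (sym p) q) λ ()
Next-injective (inj₂ (_ , p)) (inj₁ q) = contradiction (trans (sym q) p) λ ()
Next-injective (inj₂ (p , _)) (inj₂ (q , _)) = toℕ-injective (suc-injective (trans p (sym q)))

next-prev : (i : Fin (suc n)) → next (prev i) ≡ i
next-prev i = Next-functional (Next-next (prev i)) (Next-prev i)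

prev-next : (i : Fin (suc n)) → prev (next i) ≡ i
prev-next i = Next-injective (Next-prev (next i)) (Next-next i)

-- The order must be at least 2: on one vertex the wrap-around is a loop.
Next⇒≢ : ∀ {i j : Fin (2+ n)} → Next i j → i ≢ j
Next⇒≢ (inj₁ p) refl = ℕ.<⇒≢ (ℕ.n<1+n _) p
Next⇒≢ (inj₂ (p , q)) refl = contradiction (trans (cong suc (sym q)) p) λ ()

next-adj : (i : Fin (2+ n)) → Adj (C (2+ n)) i (next i)
next-adj i = Next⇒≢ (Next-next i) , inj₁ (Next-next i)

prev-adj : (i : Fin (2+ n)) → Adj (C (2+ n)) i (prev i)
prev-adj i = Next⇒≢ (Next-prev i) ∘ sym , inj₂ (Next-prev i)

-- Domino arrangements on the torus

Cell : Set
Cell = Maybe Bool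

-- The two ends of a domino along the second factor, and the empty cell.
pattern ⊏ = just false
pattern ⊐ = just true
pattern ◦ = nothing

Occupied : Cell → Set
Occupied c = is-just c ≡ true

module Arrangement {n m : ℕ} (cell : Fin (2+ n) → Fin (2+ m) → Cell) where

  Torus : Graph (Fin (2+ n * 2+ m))
  Torus = C (2+ n) ×ᶜ C (2+ m)

  occupied : Fin (2+ n * 2+ m) → Bool
  occupied = is-just ∘ uncurry cell ∘ remQuot {2+ n} (2+ m)

  D : Subset (2+ n * 2+ m)
  D = tabulate occupied

  occupied-combine : ∀ i j → occupied (combine i j) ≡ is-just (cell i j)
  occupied-combine i j = cong (is-just ∘ uncurry cell) (remQuot-combine i j)

  torusAdj? : Decidable (Adj Torus)
  torusAdj? u v = □-adj? (C (2+ n)) (C (2+ m)) (C-adj? (2+ n)) (C-adj? (2+ m))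
    (remQuot (2+ m) u) (remQuot (2+ m) v)

  ∈D⁺ : ∀ i j → Occupied (cell i j) → combine i j ∈ D
  ∈D⁺ i j occ = lookup⇒[]= _ D (trans (lookup∘tabulate occupied (combine i j))
    (trans (occupied-combine i j) occ))

  ∈D⁻ : ∀ i j → combine i j ∈ D → Occupied (cell i j)
  ∈D⁻ i j v∈D = trans (sym (occupied-combine i j))
    (trans (sym (lookup∘tabulate occupied (combine i j))) ([]=⇒lookup v∈D))

  combine-adj : ∀ i j i′ j′ → Adj (C (2+ n) □ C (2+ m)) (i , j) (i′ , j′) →
    Adj Torus (combine i j) (combine i′ j′)
  combine-adj i j i′ j′ =
    subst₂ (Adj (C (2+ n) □ C (2+ m))) (sym (remQuot-combine i j)) (sym (remQuot-combine i′ j′))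

  adj-fst : ∀ i i′ j → Adj (C (2+ n)) i i′ → Adj Torus (combine i j) (combine i′ j)
  adj-fst i i′ j e = combine-adj i j i′ j (inj₂ (e , refl))

  adj-snd : ∀ i j j′ → Adj (C (2+ m)) j j′ → Adj Torus (combine i j) (combine i j′)
  adj-snd i j j′ e = combine-adj i j i j′ (inj₁ (refl , e))

  Dominated : Fin (2+ n) → Fin (2+ m) → Set
  Dominated i j =
    Occupied (cell i j) ⊎
    Occupied (cell (prev i) j) ⊎ Occupied (cell (next i) j) ⊎
    Occupied (cell i (prev j)) ⊎ Occupied (cell i (next j))

  dominating : (∀ i j → Dominated i j) → Dominating Torus D
  dominating dominated v v∉D with combine-surjective {2+ n} {2+ m} v
  ... | i , j , refl with dominated i j
  ...   | inj₁ o                      = contradiction (∈D⁺ i j o) v∉D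
  ...   | inj₂ (inj₁ o)               = _ , ∈D⁺ (prev i) j o , adj-fst i (prev i) j (prev-adj i)
  ...   | inj₂ (inj₂ (inj₁ o))        = _ , ∈D⁺ (next i) j o , adj-fst i (next i) j (next-adj i)
  ...   | inj₂ (inj₂ (inj₂ (inj₁ o))) = _ , ∈D⁺ i (prev j) o , adj-snd i j (prev j) (prev-adj j)
  ...   | inj₂ (inj₂ (inj₂ (inj₂ o))) = _ , ∈D⁺ i (next j) o , adj-snd i j (next j) (next-adj j)

  otherEnd : Cell → Fin (2+ m) → Fin (2+ m)
  otherEnd ⊏ = next
  otherEnd ⊐ = prev
  otherEnd ◦ j = j

  mate : Fin (2+ n * 2+ m) → Fin (2+ n * 2+ m)
  mate v = let i , j = remQuot {2+ n} (2+ m) v in combine i (otherEnd (cell i j) j)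

  mate-combine : ∀ i j → mate (combine i j) ≡ combine i (otherEnd (cell i j) j)
  mate-combine i j = cong (λ (i , j) → combine i (otherEnd (cell i j) j)) (remQuot-combine i j)

  isMate : (∀ i j → cell i j ≡ ⊏ → cell i (next j) ≡ ⊐) →
           (∀ i j → cell i j ≡ ⊐ → cell i (prev j) ≡ ⊏) → IsMate Torus D mate
  isMate right left v v∈D with combine-surjective {2+ n} {2+ m} v
  -- The empty cell needs no clause: there `∈D⁻` would give `false ≡ true`.
  ... | i , j , refl rewrite mate-combine i j with cell i j in eq | ∈D⁻ i j v∈D
  ...   | ⊏ | _ = ∈D⁺ i (next j) (cong is-just (right i j eq)) , adj-snd i j (next j) (next-adj j) ,
    trans (mate-combine i (next j))
      (trans (cong (λ c → combine i (otherEnd c (next j))) (right i j eq)) (cong (combine i) (prev-next j)))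
  ...   | ⊐ | _ = ∈D⁺ i (prev j) (cong is-just (left i j eq)) , adj-snd i j (prev j) (prev-adj j) ,
    trans (mate-combine i (prev j))
      (trans (cong (λ c → combine i (otherEnd c (prev j))) (left i j eq)) (cong (combine i) (next-prev j)))

-- An extensible pattern

pattern 4+ n = 2+ (2+ n)
pattern 6+ n = 2+ (4+ n)

Phase : Set
Phase = Fin 10

-- A cycle of length 6 + 4 k is mapped to phases 0, …, 5 followed by k rounds of 6, …, 9.
phase : ℕ → Phase
phase 0 = # 0
phase 1 = # 1
phase 2 = # 2
phase 3 = # 3
phase 4 = # 4
phase 5 = # 5
phase 6 = # 6
phase 7 = # 7
phase 8 = # 8
phase 9 = # 9
-- From 10 on, 4 is subtracted; the argument stays at least 6 and so never re-enters the core.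
phase (4+ (6+ n)) = phase (6+ n)

infix 4 _⟶_ _⟶?_

-- Covers all cycle lengths at once: after phase 5 or 9 comes either another round (phase 6) or the
-- wrap-around (phase 0).
_⟶_ : Rel Phase _
s ⟶ t = toℕ t ≡ suc (toℕ s) ⊎ (toℕ s ≡ 5 ⊎ toℕ s ≡ 9) × (toℕ t ≡ 0 ⊎ toℕ t ≡ 6)

_⟶?_ : Decidable _⟶_
s ⟶? t = toℕ t ℕ.≟ suc (toℕ s) ⊎-dec
  (toℕ s ℕ.≟ 5 ⊎-dec toℕ s ℕ.≟ 9) ×-dec (toℕ t ℕ.≟ 0 ⊎-dec toℕ t ℕ.≟ 6)

phase-suc : ∀ x → phase x ⟶ phase (suc x)
phase-suc 0 = inj₁ refl
phase-suc 1 = inj₁ refl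
phase-suc 2 = inj₁ refl
phase-suc 3 = inj₁ refl
phase-suc 4 = inj₁ refl
phase-suc 5 = inj₁ refl
phase-suc 6 = inj₁ refl
phase-suc 7 = inj₁ refl
phase-suc 8 = inj₁ refl
phase-suc 9 = inj₂ (inj₂ refl , inj₂ refl)
phase-suc (4+ (6+ n)) = phase-suc (6+ n)

-- The last vertex has phase 5 if `k` is 0 and phase 9 otherwise.
phase-last : ∀ k → phase (5 + k * 4) ⟶ phase 0
phase-last 0             = inj₂ (inj₁ refl , inj₁ refl)
phase-last 1             = inj₂ (inj₂ refl , inj₁ refl)
phase-last (suc (suc k)) = phase-last (suc k)

phase-Next : ∀ k {i j : Fin (6 + k * 4)} → Next i j → phase (toℕ i) ⟶ phase (toℕ j)
phase-Next k {i} (inj₁ j≡1+i) rewrite j≡1+i = phase-suc (toℕ i)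
phase-Next k (inj₂ (1+i≡n , j≡0)) rewrite suc-injective 1+i≡n | j≡0 = phase-last k

-- Found by computer search: a 6 × 6 core (10 vertices), and 4 phases in each direction that
-- can be repeated; a copy of the 6 × 4, 4 × 6, 4 × 4 block has 8, 8, 4 vertices.
tile : Vec (Vec Cell 10) 10
tile =
  (⊏ ∷ ⊐ ∷ ◦ ∷ ◦ ∷ ◦ ∷ ◦ ∷ ⊏ ∷ ⊐ ∷ ⊏ ∷ ⊐ ∷ []) ∷
  (◦ ∷ ◦ ∷ ◦ ∷ ⊏ ∷ ⊐ ∷ ◦ ∷ ◦ ∷ ◦ ∷ ◦ ∷ ◦ ∷ []) ∷
  (⊏ ∷ ⊐ ∷ ◦ ∷ ◦ ∷ ◦ ∷ ◦ ∷ ⊏ ∷ ⊐ ∷ ◦ ∷ ◦ ∷ []) ∷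
  (◦ ∷ ◦ ∷ ◦ ∷ ◦ ∷ ◦ ∷ ◦ ∷ ◦ ∷ ◦ ∷ ◦ ∷ ◦ ∷ []) ∷
  (◦ ∷ ◦ ∷ ⊏ ∷ ⊐ ∷ ⊏ ∷ ⊐ ∷ ◦ ∷ ◦ ∷ ⊏ ∷ ⊐ ∷ []) ∷
  (◦ ∷ ◦ ∷ ◦ ∷ ◦ ∷ ◦ ∷ ◦ ∷ ◦ ∷ ◦ ∷ ◦ ∷ ◦ ∷ []) ∷
  (⊏ ∷ ⊐ ∷ ⊏ ∷ ⊐ ∷ ◦ ∷ ◦ ∷ ⊏ ∷ ⊐ ∷ ◦ ∷ ◦ ∷ []) ∷
  (◦ ∷ ◦ ∷ ◦ ∷ ◦ ∷ ◦ ∷ ◦ ∷ ◦ ∷ ◦ ∷ ◦ ∷ ◦ ∷ []) ∷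
  (◦ ∷ ◦ ∷ ⊏ ∷ ⊐ ∷ ⊏ ∷ ⊐ ∷ ◦ ∷ ◦ ∷ ⊏ ∷ ⊐ ∷ []) ∷
  (◦ ∷ ◦ ∷ ◦ ∷ ◦ ∷ ◦ ∷ ◦ ∷ ◦ ∷ ◦ ∷ ◦ ∷ ◦ ∷ []) ∷ []

tileAt : Phase → Phase → Cell
tileAt s t = lookup (lookup tile s) t

_≟ᶜ_ : Decidable {A = Cell} _≡_
_≟ᶜ_ = Maybe.≡-dec Bool._≟_

occupied? : ∀ c → Dec (Occupied c)
occupied? c = is-just c Bool.≟ true

-- No domino crosses a cut: `⊏` is absent from columns 5 and 9, and `⊐` from columns 0 and 6.
-- Verified by evaluating the decision procedure.
tile-right : ∀ s t → tileAt s t ≡ ⊏ → ∀ t′ → t ⟶ t′ → tileAt s t′ ≡ ⊐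
tile-right = from-yes (Fin.all? λ s → Fin.all? λ t → tileAt s t ≟ᶜ ⊏ →-dec
  Fin.all? λ t′ → t ⟶? t′ →-dec tileAt s t′ ≟ᶜ ⊐)

tile-left : ∀ s t → tileAt s t ≡ ⊐ → ∀ t′ → t′ ⟶ t → tileAt s t′ ≡ ⊏
tile-left = from-yes (Fin.all? λ s → Fin.all? λ t → tileAt s t ≟ᶜ ⊐ →-dec
  Fin.all? λ t′ → t′ ⟶? t →-dec tileAt s t′ ≟ᶜ ⊏)

-- Stronger than domination: one direction serves for all possible neighbouring phases.
tile-dominated : ∀ s t →
  Occupied (tileAt s t) ⊎
  (∀ s′ → s′ ⟶ s → Occupied (tileAt s′ t)) ⊎ (∀ s′ → s ⟶ s′ → Occupied (tileAt s′ t)) ⊎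
  (∀ t′ → t′ ⟶ t → Occupied (tileAt s t′)) ⊎ (∀ t′ → t ⟶ t′ → Occupied (tileAt s t′))
tile-dominated = from-yes (Fin.all? λ s → Fin.all? λ t →
  occupied? (tileAt s t) ⊎-dec
  (Fin.all? λ s′ → s′ ⟶? s →-dec occupied? (tileAt s′ t)) ⊎-dec
  (Fin.all? λ s′ → s ⟶? s′ →-dec occupied? (tileAt s′ t)) ⊎-dec
  (Fin.all? λ t′ → t′ ⟶? t →-dec occupied? (tileAt s t′)) ⊎-dec
  (Fin.all? λ t′ → t ⟶? t′ →-dec occupied? (tileAt s t′)))

-- Size of the pattern

indicator : Bool → ℕ
indicator b = if b then 1 else 0

∣tabulate∣ : (f : Fin n → Bool) → ∣ tabulate f ∣ ≡ sum (indicator ∘ f)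
∣tabulate∣ {zero}  f = refl
∣tabulate∣ {suc n} f with f zero
... | true  = cong suc (∣tabulate∣ (f ∘ suc))
... | false = ∣tabulate∣ (f ∘ suc)

sum-↑ : ∀ m (f : Fin (m + n) → ℕ) → sum f ≡ sum (f ∘ (_↑ˡ n)) + sum (f ∘ (m ↑ʳ_))
sum-↑ zero    f = refl
sum-↑ (suc m) f = trans (cong (f zero +_) (sum-↑ m (f ∘ suc))) (sym (+-assoc (f zero) _ _))

sum-combine : ∀ n m (f : Fin (n * m) → ℕ) → sum f ≡ sum λ i → sum λ j → f (combine {n} i j)
sum-combine zero    m f = refl
sum-combine (suc n) m f =
  trans (sum-↑ m f) (cong (sum (f ∘ (_↑ˡ n * m)) +_) (sum-combine n m (f ∘ (m ↑ʳ_))))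

coreSum periodSum : (Phase → ℕ) → ℕ
coreSum   g = g (# 0) + (g (# 1) + (g (# 2) + (g (# 3) + (g (# 4) + g (# 5)))))
periodSum g = g (# 6) + (g (# 7) + (g (# 8) + g (# 9)))

sum-phase : ∀ k (g : Phase → ℕ) →
  sum {6 + k * 4} (g ∘ phase ∘ toℕ) ≡ coreSum g + k * periodSum g
sum-phase k g = trans (cong core+ (sum-period k)) (reassoc (g (# 0)) (g (# 1)) (g (# 2)) (g (# 3)) (g (# 4)) (g (# 5)) _)
  where
  core+ : ℕ → ℕ
  core+ x = g (# 0) + (g (# 1) + (g (# 2) + (g (# 3) + (g (# 4) + (g (# 5) + x)))))

  reassoc : ∀ a b c d e f x → a + (b + (c + (d + (e + (f + x))))) ≡ a + (b + (c + (d + (e + f)))) + x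
  reassoc = solve-∀

  reassoc₄ : ∀ a b c d x → a + (b + (c + (d + x))) ≡ a + (b + (c + d)) + x
  reassoc₄ = solve-∀

  sum-period : ∀ k → sum {k * 4} (λ i → g (phase (6+ (toℕ i)))) ≡ k * periodSum g
  sum-period zero    = refl
  sum-period (suc k) =
    -- The first four terms have phases 6 to 9 by computation; the last clause of `phase` turns the
    -- remaining ones into the sum for `k`.
    trans (cong (λ x → g (# 6) + (g (# 7) + (g (# 8) + (g (# 9) + x)))) (sum-period k))
          (reassoc₄ (g (# 6)) (g (# 7)) (g (# 8)) (g (# 9)) _)

-- The pattern on the torus with sides 6 + 4a and 6 + 4b

module Pattern (a b : ℕ) where

  cell : Fin (6 + a * 4) → Fin (6 + b * 4) → Cell
  cell i j = tileAt (phase (toℕ i)) (phase (toℕ j))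

  open Arrangement cell

  dominated : ∀ i j → Dominated i j
  dominated i j =
    Sum.map₂ (Sum.map (λ h → h _ (phase-Next a (Next-prev i)))
      (Sum.map (λ h → h _ (phase-Next a (Next-next i)))
        (Sum.map (λ h → h _ (phase-Next b (Next-prev j)))
                 (λ h → h _ (phase-Next b (Next-next j))))))
    (tile-dominated (phase (toℕ i)) (phase (toℕ j)))

  pairedDominating : PairedDominating Torus D
  pairedDominating = dominating dominated , mate⇒perfectMatching Torus (isMate
    (λ i j eq → tile-right (phase (toℕ i)) _ eq _ (phase-Next b (Next-next j)))
    (λ i j eq → tile-left (phase (toℕ i)) _ eq _ (phase-Next b (Next-prev j))))

  weight : Phase → Phase → ℕ
  weight s t = indicator (is-just (tileAt s t))

  ∣D∣ : ∣ D ∣ ≡ 10 + 8 * a + 8 * b + 4 * a * b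
  ∣D∣ = begin
    ∣ D ∣
      ≡⟨ ∣tabulate∣ occupied ⟩
    sum (indicator ∘ occupied)
      ≡⟨ sum-combine (6 + a * 4) (6 + b * 4) (indicator ∘ occupied) ⟩
    sum {6 + a * 4} (λ i → sum {6 + b * 4} λ j → indicator (occupied (combine i j)))
      ≡⟨ sum-cong-≗ {6 + a * 4} (λ i → sum-cong-≗ {6 + b * 4} λ j →
           cong indicator (occupied-combine i j)) ⟩
    sum {6 + a * 4} (λ i → sum {6 + b * 4} λ j → weight (phase (toℕ i)) (phase (toℕ j)))
      ≡⟨ sum-cong-≗ {6 + a * 4} (λ i → sum-phase b (weight (phase (toℕ i)))) ⟩
    sum {6 + a * 4} (λ i → coreSum (weight (phase (toℕ i))) + b * periodSum (weight (phase (toℕ i))))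
      ≡⟨ sum-phase a (λ s → coreSum (weight s) + b * periodSum (weight s)) ⟩
    coreSum (λ s → coreSum (weight s) + b * periodSum (weight s)) +
    a * periodSum (λ s → coreSum (weight s) + b * periodSum (weight s))
      ≡⟨ arithmetic a b ⟩
    10 + 8 * a + 8 * b + 4 * a * b ∎
    where
    open ≡-Reasoning
    -- Each `p + b * q` is one row of `tile`, with `p` occupied cells in its first six columns and
    -- `q` in its last four.
    arithmetic : ∀ a b →
      2 + b * 4 + (2 + b * 0 + (2 + b * 2 + (0 + b * 0 + (4 + b * 2 + (0 + b * 0))))) +
      a * (4 + b * 2 + (0 + b * 0 + (4 + b * 2 + (0 + b * 0)))) ≡ 10 + 8 * a + 8 * b + 4 * a * b
    arithmetic = solve-∀

-- Arithmetic of the bound and conclusion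

n≡6+k*4 : ∀ n → 5 ≤ n → n % 4 ≡ 2 → ∃[ k ] n ≡ 6 + k * 4
n≡6+k*4 n 5≤n n%4≡2 with n / 4 | trans (m≡m%n+[m/n]*n n 4) (cong (_+ n / 4 * 4) n%4≡2)
-- Quotient 0 means `n` is 2, which is below 5; hence the lengths start at 6.
... | zero  | refl = contradiction 5≤n λ { (s≤s (s≤s ())) }
... | suc k | n≡   = k , n≡

-- Both factors are multiples of 4, so the division is exact; the quotient is the size plus 6, so
-- the truncated subtraction is exact too.
bound : ∀ a b → 10 + 8 * a + 8 * b + 4 * a * b ≡ ((6 + a * 4 + 2) * (6 + b * 4 + 2)) / 4 ∸ 6
bound a b = sym (begin
  ((6 + a * 4 + 2) * (6 + b * 4 + 2)) / 4 ∸ 6        ≡⟨ cong (λ x → x / 4 ∸ 6) (factor a b) ⟩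
  (10 + 8 * a + 8 * b + 4 * a * b + 6) * 4 / 4 ∸ 6   ≡⟨ cong (_∸ 6) (m*n/n≡m (10 + 8 * a + 8 * b + 4 * a * b + 6) 4) ⟩
  10 + 8 * a + 8 * b + 4 * a * b + 6 ∸ 6             ≡⟨ m+n∸n≡m (10 + 8 * a + 8 * b + 4 * a * b) 6 ⟩
  10 + 8 * a + 8 * b + 4 * a * b                     ∎)
  where
  open ≡-Reasoning
  factor : ∀ a b → (6 + a * 4 + 2) * (6 + b * 4 + 2) ≡ (10 + 8 * a + 8 * b + 4 * a * b + 6) * 4
  factor = solve-∀

theorem5p5 : ∀ (n m : ℕ) → 5 ≤ n → 5 ≤ m → m % 4 ≡ 2 → n % 4 ≡ 2 →
    ∃[ γ ] (IsPairedDominationNumber (C n ×ᶜ C m) γ × γ ≤ ((n + 2) * (m + 2)) / 4 ∸ 6)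
theorem5p5 n m 5≤n 5≤m m%4≡2 n%4≡2 with n≡6+k*4 n 5≤n n%4≡2 | n≡6+k*4 m 5≤m m%4≡2
... | a , refl | b , refl =
  let γ , isγ , γ≤∣D∣ = pairedDominationNumber-≤ Torus torusAdj? D pairedDominating
  in γ , isγ , ≤-trans γ≤∣D∣ (≤-reflexive (trans ∣D∣ (bound a b)))
  where
  open Pattern a b
  open Arrangement cell
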